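{- Every ($P_5$, $C_5$, house, co-banner)-free graph $G$ on $n$ vertices is recolorable, and the diameter of $R_\ell(G)$ is at most $2n^2$ for all $\ell\ge\chi(G)+1$.
   Context: All graphs are finite and simple. A $k$-coloring of $G$ is a map $V(G)\to\{1,\dots,k\}$ giving adjacent vertices different values; $\chi(G)$ is the chromatic number. $R_k(G)$ denotes the graph whose vertices are the $k$-colorings of $G$, two being adjacent if they differ in color on exactly one vertex. $G$ is recolorable if $R_\ell(G)$ is connected for all $\ell\ge\chi(G)+1$. A graph is $(H_1,\dots,H_r)$-free if it has no induced subgraph isomorphic to any $H_i$. $P_5$ and $C_5$ are the path and cycle on 5 vertices. The house is the complement of $P_5$ (a 4-cycle plus a fifth vertex adjacent to exactly two consecutive vertices of the cycle). The co-banner is the graph on vertices $a,b,c,d,e$ with edge set $\{ab, ac, bc, cd, de\}$. -}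

module Defs where

open import Data.Empty using (⊥-elim)
open import Data.Fin using (Fin; _≟_; #_)
open import Data.Fin.Properties using (all?; any?)
open import Data.List using (List; []; _∷_)
import Data.List.Relation.Unary.All as All
open import Data.List.Membership.Propositional using (_∈_)
import Data.List.Membership.DecPropositional as DecMembership
open import Data.Nat using (ℕ; zero; suc; _+_; _≤_; _≥_; z≤n; s≤s)
open import Data.Product using (Σ; ∃; ∃₂; ∃-syntax; _×_; _,_; proj₁)
open import Data.Product.Properties using (≡-dec)
open import Data.Sum using (_⊎_; inj₁; inj₂; swap)
open import Data.Vec using (Vec; []; _∷_; lookup; tabulate)
open import Data.Vec.Properties using (lookup∘tabulate)
open import Function using (_∘_; id)
open import Function.Bundles using (_⇔_)
open import Function.Definitions using (Injective)
open import Level using (0ℓ)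
open import Relation.Binary using (Rel; Setoid; Decidable; Symmetric; Irreflexive; _Respects₂_)
open import Relation.Binary.PropositionalEquality
  using (_≡_; _≢_; refl; trans) renaming (sym to ≡-sym)
open import Relation.Nullary using (¬_; Dec; yes; no)
open import Relation.Nullary.Decidable
  using (True; toWitness; map′; ¬?; _×-dec_; _⊎-dec_; _→-dec_)
import Relation.Unary as U

-- Decidability of adjacency is part of the data: constructively it is what
-- makes the graph a finite object.
record Graph (n : ℕ) : Set₁ where
  field
    Adj    : Rel (Fin n) 0ℓ
    adj?   : Decidable Adj
    sym    : Symmetric Adj
    irrefl : Irreflexive _≡_ Adj

complement : ∀ {n} → Graph n → Graph n
complement G = record
  { Adj    = λ u v → u ≢ v × ¬ Adj u v
  ; adj?   = λ u v → ¬? (u ≟ v) ×-dec ¬? (adj? u v)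
  ; sym    = λ (u≢v , ¬uv) → (λ v≡u → u≢v (≡-sym v≡u)) , (λ vu → ¬uv (G-sym vu))
  ; irrefl = λ u≡v (u≢v , _) → u≢v u≡v
  }
  where
  open Graph G renaming (sym to G-sym)

fromEdges : ∀ {n} (es : List (Fin n × Fin n)) →
            {True (All.all? (λ (u , v) → ¬? (u ≟ v)) es)} → Graph n
fromEdges es {loopless} = record
  { Adj    = λ u v → (u , v) ∈ es ⊎ (v , u) ∈ es
  ; adj?   = λ u v → ((u , v) ∈? es) ⊎-dec ((v , u) ∈? es)
  ; sym    = swap
  ; irrefl = λ { refl (inj₁ e) → noLoop e ; refl (inj₂ e) → noLoop e }
  }
  where
  open DecMembership (≡-dec _≟_ _≟_) using (_∈?_)
  noLoop : ∀ {u} → ¬ (u , u) ∈ es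
  noLoop e = All.lookup (toWitness loopless) e refl

P₅ C₅ house coBanner : Graph 5
P₅ = fromEdges
  ((# 0 , # 1) ∷ (# 1 , # 2) ∷ (# 2 , # 3) ∷ (# 3 , # 4) ∷ [])
C₅ = fromEdges
  ((# 0 , # 1) ∷ (# 1 , # 2) ∷ (# 2 , # 3) ∷ (# 3 , # 4) ∷ (# 4 , # 0) ∷ [])
house = complement P₅
coBanner = fromEdges
  ((# 0 , # 1) ∷ (# 0 , # 2) ∷ (# 1 , # 2) ∷ (# 2 , # 3) ∷ (# 3 , # 4) ∷ [])

-- An isomorphism from H onto the subgraph of G induced by the image of f.
record InducedCopy {m n} (H : Graph m) (G : Graph n) : Set where
  field
    f         : Fin m → Fin n
    injective : Injective _≡_ _≡_ f
    adj⇔      : ∀ u v → Graph.Adj H u v ⇔ Graph.Adj G (f u) (f v)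

_-Free : ∀ {m n} → Graph m → Graph n → Set
(H -Free) G = ¬ InducedCopy H G

IsLeast : (ℕ → Set) → ℕ → Set
IsLeast P m = P m × (∀ k → P k → m ≤ k)

least : {P : ℕ → Set} → U.Decidable P → ∀ n → P n → ∃ (IsLeast P)
least P? zero    p = zero , p , λ _ _ → z≤n
least P? (suc n) p with P? zero
... | yes p₀ = zero , p₀ , λ _ _ → z≤n
... | no ¬p₀ with least (P? ∘ suc) n p
...   | m , pm , min = suc m , pm , λ { zero p₀ → ⊥-elim (¬p₀ p₀)
                                     ; (suc k) pk → s≤s (min k pk) }

module _ {n : ℕ} (G : Graph n) where
  open Graph G

  Proper : ∀ {k} → (Fin n → Fin k) → Set
  Proper c = ∀ u v → Adj u v → c u ≢ c v

  Coloring : ℕ → Set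
  Coloring k = Σ (Fin n → Fin k) Proper

  proper? : ∀ {k} (c : Fin n → Fin k) → Dec (Proper c)
  proper? c = all? λ u → all? λ v → adj? u v →-dec ¬? (c u ≟ c v)

  IsChromaticNumber : ℕ → Set
  IsChromaticNumber = IsLeast Coloring

anyVec? : ∀ {k} n {P : Vec (Fin k) n → Set} → U.Decidable P → Dec (∃ P)
anyVec? zero    P? = map′ ([] ,_) (λ { ([] , p) → p }) (P? [])
anyVec? (suc n) P? = map′ (λ (x , xs , p) → x ∷ xs , p)
                          (λ { (x ∷ xs , p) → x , xs , p })
                          (any? λ x → anyVec? n λ xs → P? (x ∷ xs))

coloring? : ∀ {n} (G : Graph n) k → Dec (Coloring G k)
coloring? {n} G k = map′ (λ (xs , p) → lookup xs , p)
                         (λ (c , p) → tabulate c , tabulate-proper c p)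
                         (anyVec? n (λ xs → proper? G (lookup xs)))
  where
  tabulate-proper : (c : Fin n → Fin k) → Proper G c → Proper G (lookup (tabulate c))
  tabulate-proper c p u v uv eq = p u v uv
    (trans (≡-sym (lookup∘tabulate c u)) (trans eq (lookup∘tabulate c v)))

chromaticNumber : ∀ {n} (G : Graph n) → ∃ (IsChromaticNumber G)
chromaticNumber {n} G =
  least (coloring? G) n (id , λ u v uv u≡v → Graph.irrefl G u≡v uv)

χ : ∀ {n} → Graph n → ℕ
χ G = proj₁ (chromaticNumber G)

-- Colorings are functions carrying proofs, so they are compared pointwise
-- rather than by _≡_; hence graphs whose vertices form a setoid.
record SetoidGraph : Set₁ where
  field
    vertices : Setoid 0ℓ 0ℓ
  open Setoid vertices public using (_≈_) renaming (Carrier to Vertex)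
  field
    Adj    : Rel Vertex 0ℓ
    resp   : Adj Respects₂ _≈_
    sym    : Symmetric Adj
    irrefl : Irreflexive _≈_ Adj

module _ (H : SetoidGraph) where
  open SetoidGraph H

  data Walk : Vertex → Vertex → ℕ → Set where
    [_] : ∀ {u v} → u ≈ v → Walk u v 0
    _∷_ : ∀ {u v w k} → Adj u v → Walk v w k → Walk u w (suc k)

  Connected : Set
  Connected = ∀ u v → ∃ (Walk u v)

  IsDistance : Vertex → Vertex → ℕ → Set
  IsDistance u v = IsLeast (Walk u v)

  -- The maximum distance exists and equals d; in particular H is nonempty
  -- and all its distances are finite.
  IsDiameter : ℕ → Set
  IsDiameter d = (∃₂ λ u v → IsDistance u v d)
               × (∀ u v → ∃[ e ] IsDistance u v e × e ≤ d)

R : ∀ {n} → ℕ → Graph n → SetoidGraph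
R {n} k G = record
  { vertices = record
    { Carrier       = Coloring G k
    ; _≈_           = λ (c , _) (d , _) → ∀ v → c v ≡ d v
    ; isEquivalence = record
      { refl  = λ _ → refl
      ; sym   = λ p v → ≡-sym (p v)
      ; trans = λ p q v → trans (p v) (q v)
      }
    }
  ; Adj    = λ (c , _) (d , _) → DifferAtOne c d
  ; resp   = (λ p (v , c≢d , same) → v , (λ eq → c≢d (trans eq (≡-sym (p v))))
                                       , λ u u≢v → trans (same u u≢v) (p u))
           , (λ p (v , c≢d , same) → v , (λ eq → c≢d (trans (p v) eq))
                                       , λ u u≢v → trans (≡-sym (p u)) (same u u≢v))
  ; sym    = λ (v , c≢d , same) → v , (λ eq → c≢d (≡-sym eq))
                                    , λ u u≢v → ≡-sym (same u u≢v)
  ; irrefl = λ p (v , c≢d , _) → c≢d (p v)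
  }
  where
  DifferAtOne : Rel (Fin n → Fin k) 0ℓ
  DifferAtOne c d = ∃[ v ] c v ≢ d v × (∀ u → u ≢ v → c u ≡ d u)

Recolorable : ∀ {n} → Graph n → Set
Recolorable G = ∀ ℓ → ℓ ≥ χ G + 1 → Connected (R ℓ G)

{-# OPTIONS --safe #-}
module Submission where

open import Data.Bool using (Bool; true; false)
open import Data.Fin using (Fin; zero; suc; _≟_; inject≤; #_)
import Data.Fin as Fin
open import Data.Fin.Properties
  using (any?; all?; ¬∀⟶∃¬; injective⇒≤; inject≤-injective; <-cmp)
open import Data.List using (List; []; _∷_; length; filter; lookup; allFin)
import Data.List.Membership.DecPropositional as DecMembership
open import Data.List.Membership.Propositional using (_∈_; _∉_; find; lose)
open import Data.List.Membership.Propositional.Properties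
  using (∈-filter⁺; ∈-filter⁻; ∈-allFin; ∈-lookup)
open import Data.List.Properties using (filter-notAll; length-tabulate)
import Data.List.Relation.Unary.All as All
open import Data.List.Relation.Unary.Any as Any using (Any; here; there)
open import Data.List.Relation.Unary.Any.Properties using (lookup-index)
open import Data.List.Relation.Unary.Unique.Propositional using (Unique; []; _∷_)
import Data.List.Relation.Unary.Unique.Propositional.Properties as Unique
open import Data.Nat
  using (ℕ; zero; suc; _+_; _*_; _^_; _≤_; _<_; _≥_; z≤n; s≤s; s≤s⁻¹; _≤?_)
open import Data.Nat.Properties
  using ( ≤-refl; ≤-trans; ≤-reflexive; ≤-antisym; ≤-total; ≰⇒>; n≤1+n; 1+n≰n; m≤m+n; m≤n+m
        ; m+n≤o⇒m≤o; +-mono-≤; +-monoˡ-≤; +-monoʳ-≤; *-monoʳ-≤; +-suc; +-comm; +-assoc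
        ; +-identityʳ; *-identityʳ; *-distribˡ-+; module ≤-Reasoning)
open import Data.Product using (∃; ∃-syntax; ∃₂; _×_; _,_; proj₁; proj₂)
open import Data.Sum using (_⊎_; inj₁; inj₂)
import Data.Vec as Vec
open import Data.Vec using ([]; _∷_)
open import Data.Vec.Functional using (updateAt)
open import Data.Vec.Functional.Properties using (updateAt-updates; updateAt-minimal)
open import Data.Vec.Properties using (lookup∘tabulate)
open import Function using (_∘_; id; const)
open import Function.Bundles using (_⇔_; mk⇔; Equivalence)
open import Function.Definitions using (Injective)
open import Level using (0ℓ)
open import Relation.Binary using (Setoid; tri<; tri≈; tri>)
open import Relation.Binary.PropositionalEquality
  using (_≡_; _≢_; refl; sym; trans; cong; cong₂; subst; ≢-sym)
open import Relation.Nullary using (¬_; Dec; yes; no; does; contradiction)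
open import Relation.Nullary.Decidable
  using (¬?; _×-dec_; _→-dec_; map′; decidable-stable)
open import Relation.Unary using (Pred; U; Decidable)
open import Defs

-- Every vertex set S of G carries a retraction ρ onto a clique k such that any
-- coloring of S with a spare color can be moved to one factoring through ρ,
-- moving each vertex at most |S| - |k| times.  If S is not complete, either
-- N(u) ⊆ N(v) for some nonadjacent u, v (put A = {u}, B = {v}), or there are
-- two anticomplete modules A, B: given an induced 2K₂, grow its edges to
-- connected sets; P₅- and co-banner-freeness force every vertex with neighbors
-- in both to be complete to both.  If there is neither such a pair u, v nor a
-- 2K₂, any nonadjacent pair extends to an induced C₅ or house.
-- By induction A, B and S \ A have such retractions.  Say that the clique of A
-- is not larger than the clique of B; then A folds into the clique of B.  If A
-- uses a color missing on that clique, A has a spare color and can be recolored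
-- so that it mimics the clique of B, and then it follows the moves of S \ A.
-- Otherwise every vertex of A already mimics the clique vertex of its own color,
-- so S \ A can be moved first; this frees a color, and A is recolored last.
-- Finally, two colorings factoring through ρ differ by moving the colors of a
-- clique with one spare color around.

-- Recoloring sequences and their transport between graphs.

-- κ bounds how often each vertex is recolored; the values of the colorings
-- outside S are junk.
data Path {n ℓ} (G : Graph n) (S : Pred (Fin n) 0ℓ) (L : Pred (Fin ℓ) 0ℓ) :
          (Fin n → ℕ) → (c d : Fin n → Fin ℓ) → Set where
  done : ∀ {κ c d} → (∀ {v} → S v → c v ≡ d v) → Path G S L κ c d
  step : ∀ {κ κ′ c c′ d} v → S v → L (c′ v) →
         (∀ {u} → S u → u ≢ v → c u ≡ c′ u) →
         (∀ {u} → S u → Graph.Adj G u v → c u ≢ c′ v) →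
         suc (κ v) ≤ κ′ v → (∀ u → κ u ≤ κ′ u) →
         Path G S L κ c′ d → Path G S L κ′ c d

ProperOn : ∀ {n ℓ} → Graph n → Pred (Fin n) 0ℓ → (Fin n → Fin ℓ) → Set
ProperOn G S c = ∀ {u v} → S u → S v → Graph.Adj G u v → c u ≢ c v

-- Equivalently, L contains more than m colors.
Roomy : ∀ {ℓ} → ℕ → Pred (Fin ℓ) 0ℓ → Set
Roomy {ℓ} m L = ∀ (γ : Fin m → Fin ℓ) → ∃ λ a → L a × (∀ i → γ i ≢ a)

-- Pigeonhole: if `γ` took every value `h j`, choosing preimages would inject `Fin p` into `Fin m`.
roomy : ∀ {m p ℓ} {L : Pred (Fin ℓ) 0ℓ} (h : Fin p → Fin ℓ) → Injective _≡_ _≡_ h →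
        (∀ j → L (h j)) → m < p → Roomy m L
roomy {m} h h-inj hL m<p γ with any? (λ j → all? (λ i → ¬? (γ i ≟ h j)))
... | yes (j , free) = h j , hL j , free
... | no ¬free = contradiction (≤-trans m<p (injective⇒≤ σ-inj)) 1+n≰n
  where
  hit : ∀ j → ∃ λ i → γ i ≡ h j
  hit j with any? (λ i → γ i ≟ h j)
  ... | yes p = p
  ... | no ¬p = contradiction (j , λ i eq → ¬p (i , eq)) ¬free
  σ-inj : Injective _≡_ _≡_ (proj₁ ∘ hit)
  σ-inj {i} {j} eq = h-inj (trans (sym (proj₂ (hit i))) (trans (cong γ eq) (proj₂ (hit j))))

module _ {n ℓ} {G : Graph n} {S : Pred (Fin n) 0ℓ} {L : Pred (Fin ℓ) 0ℓ} where
  open Graph G using (Adj; irrefl) renaming (sym to Adj-sym)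

  reset : ∀ {κ κ′ c c′ d} → (∀ {v} → S v → c v ≡ c′ v) → (∀ v → κ v ≤ κ′ v) →
          Path G S L κ c′ d → Path G S L κ′ c d
  reset eq le (done eq′) = done λ s → trans (eq s) (eq′ s)
  reset eq le (step v Sv La same ok κv κ≤ p) =
    step v Sv La (λ s ne → trans (eq s) (same s ne)) (λ s a e → ok s a (trans (sym (eq s)) e))
      (≤-trans κv (le v)) (λ u → ≤-trans (κ≤ u) (le u)) p

  retarget : ∀ {κ c d e} → Path G S L κ c d → (∀ {v} → S v → d v ≡ e v) → Path G S L κ c e
  retarget (done eq) eq′ = done λ s → trans (eq s) (eq′ s)
  retarget (step v Sv La same ok κv κ≤ p) eq′ = step v Sv La same ok κv κ≤ (retarget p eq′)

  weaken : ∀ {κ κ′ c d} → (∀ v → κ v ≤ κ′ v) → Path G S L κ c d → Path G S L κ′ c d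
  weaken = reset (λ _ → refl)

  _◅◅_ : ∀ {κ₁ κ₂ c d e} → Path G S L κ₁ c d → Path G S L κ₂ d e →
         Path G S L (λ v → κ₁ v + κ₂ v) c e
  _◅◅_ {κ₁} {κ₂} (done eq) q = reset eq (λ v → m≤n+m (κ₂ v) (κ₁ v)) q
  _◅◅_ {κ₂ = κ₂} (step v Sv La same ok κv κ≤ p) q =
    step v Sv La same ok (+-monoˡ-≤ (κ₂ v) κv) (λ u → +-monoˡ-≤ (κ₂ u) (κ≤ u)) (p ◅◅ q)

  path-proper : ∀ {κ c d} → Path G S L κ c d → ProperOn G S c → ProperOn G S d
  path-proper (done eq) pc Su Sv uv e = pc Su Sv uv (trans (eq Su) (trans e (sym (eq Sv))))
  path-proper {c = c} (step {c′ = c′} x Sx La same ok _ _ p) pc = path-proper p pc′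
    where
    pc′ : ProperOn G S c′
    pc′ {u} {v} Su Sv uv e with u ≟ x | v ≟ x
    ... | yes refl | yes refl = irrefl refl uv
    ... | yes refl | no v≢x = ok Sv (Adj-sym uv) (trans (same Sv v≢x) (sym e))
    ... | no u≢x | yes refl = ok Su uv (trans (same Su u≢x) e)
    ... | no u≢x | no v≢x = pc Su Sv uv (trans (same Su u≢x) (trans e (sym (same Sv v≢x))))

  path-colors : ∀ {κ c d} → Path G S L κ c d → (∀ {v} → S v → L (c v)) → ∀ {v} → S v → L (d v)
  path-colors (done eq) cL s = subst L (eq s) (cL s)
  path-colors {c = c} (step {c′ = c′} x Sx La same ok _ _ p) cL = path-colors p c′L
    where
    c′L : ∀ {v} → S v → L (c′ v)
    c′L {v} s with v ≟ x
    ... | yes refl = La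
    ... | no v≢x = subst L (same s v≢x) (cL s)

  -- The order of `xs` does not matter: each new color is compared with both the old and the new
  -- color of every neighbor, so a move is legal whichever neighbors have moved already.
  recolor : ∀ {κ κ′ c c′ d} xs → Unique xs → (∀ {x} → x ∈ xs → S x) →
            (∀ {u} → S u → u ∉ xs → c u ≡ c′ u) → (∀ {x} → x ∈ xs → L (c′ x)) →
            (∀ {x u} → x ∈ xs → S u → Adj u x → c u ≢ c′ x × c′ u ≢ c′ x) →
            (∀ {x} → x ∈ xs → suc (κ x) ≤ κ′ x) → (∀ u → κ u ≤ κ′ u) →
            Path G S L κ c′ d → Path G S L κ′ c d
  recolor [] _ _ same _ _ _ κ≤ p = reset (λ s → same s λ ()) κ≤ p
  recolor {κ} {κ′} {c} {c′} (x ∷ xs) (x∉ ∷ xs!) xsS same newL ok κ< κ≤ p =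
    step x (xsS (here refl)) (subst L (sym c₁x) (newL (here refl)))
      (λ _ u≢x → sym (updateAt-minimal _ x c u≢x))
      (λ s a e → proj₁ (ok (here refl) s a) (trans e c₁x))
      (≤-trans (s≤s (≤-reflexive (updateAt-updates x κ′))) (κ< (here refl)))
      κ₁≤κ′
      (recolor xs xs! (xsS ∘ there) same₁ (newL ∘ there) ok₁ κ<₁ κ≤₁ p)
    where
    c₁ = updateAt c x (const (c′ x))
    -- Only `x` has spent its move; the rest of `xs` keeps the allowance `κ′`.
    κ₁ = updateAt κ′ x (const (κ x))
    c₁x : c₁ x ≡ c′ x
    c₁x = updateAt-updates x c
    κ₁≤κ′ : ∀ u → κ₁ u ≤ κ′ u
    κ₁≤κ′ u with u ≟ x
    ... | yes refl = ≤-trans (≤-reflexive (updateAt-updates x κ′)) (κ≤ x)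
    ... | no u≢x = ≤-reflexive (updateAt-minimal u x κ′ u≢x)
    same₁ : ∀ {u} → S u → u ∉ xs → c₁ u ≡ c′ u
    same₁ {u} s u∉ with u ≟ x
    ... | yes refl = c₁x
    ... | no u≢x = trans (updateAt-minimal u x c u≢x)
                         (same s λ { (here e) → u≢x e ; (there i) → u∉ i })
    ok₁ : ∀ {y u} → y ∈ xs → S u → Adj u y → c₁ u ≢ c′ y × c′ u ≢ c′ y
    ok₁ {y} {u} y∈ s a with u ≟ x
    ... | yes refl = (λ e → proj₂ (ok (there y∈) s a) (trans (sym c₁x) e)) , proj₂ (ok (there y∈) s a)
    ... | no u≢x = (λ e → proj₁ (ok (there y∈) s a) (trans (sym (updateAt-minimal u x c u≢x)) e))
                   , proj₂ (ok (there y∈) s a)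
    κ<₁ : ∀ {y} → y ∈ xs → suc (κ y) ≤ κ₁ y
    κ<₁ {y} y∈ = ≤-trans (κ< (there y∈))
      (≤-reflexive (sym (updateAt-minimal y x κ′ (λ e → All.lookup x∉ y∈ (sym e)))))
    κ≤₁ : ∀ u → κ u ≤ κ₁ u
    κ≤₁ u with u ≟ x
    ... | yes refl = ≤-reflexive (sym (updateAt-updates x κ′))
    ... | no u≢x = ≤-trans (κ≤ u) (≤-reflexive (sym (updateAt-minimal u x κ′ u≢x)))

-- When x is recolored, all vertices of its (independent) fiber follow.
lift : ∀ {n n′ ℓ} {G : Graph n} {H : Graph n′} {S : List (Fin n)} {S′ : Pred (Fin n′) 0ℓ}
       {L : Pred (Fin ℓ) 0ℓ} {κ c d} → Unique S → (f : Fin n → Fin n′) →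
       (∀ {u} → u ∈ S → S′ (f u)) →
       (∀ {u v} → u ∈ S → v ∈ S → Graph.Adj G u v → Graph.Adj H (f u) (f v)) →
       Path H S′ L κ c d → Path G (_∈ S) L (κ ∘ f) (c ∘ f) (d ∘ f)
lift S! f fS hom (done eq) = done (eq ∘ fS)
lift {G = G} {H} {S} {L = L} S! f fS hom (step {κ} {κ′} {c} {c′} v Sv La same ok κv κ≤ p) =
  recolor (filter (λ u → f u ≟ v) S) (Unique.filter⁺ (λ u → f u ≟ v) S!)
    (proj₁ ∘ fiber⁻)
    (λ s u∉ → same (fS s) (λ e → u∉ (∈-filter⁺ (λ u → f u ≟ v) s e)))
    (λ x∈ → subst (L ∘ c′) (sym (proj₂ (fiber⁻ x∈))) La)
    ok′
    (λ x∈ → subst (λ y → suc (κ y) ≤ κ′ y) (sym (proj₂ (fiber⁻ x∈))) κv)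
    (κ≤ ∘ f)
    (lift S! f fS hom p)
  where
  fiber⁻ : ∀ {x} → x ∈ filter (λ u → f u ≟ v) S → x ∈ S × f x ≡ v
  fiber⁻ = ∈-filter⁻ (λ u → f u ≟ v)
  ok′ : ∀ {x u} → x ∈ filter (λ u → f u ≟ v) S → u ∈ S → Graph.Adj G u x →
        c (f u) ≢ c′ (f x) × c′ (f u) ≢ c′ (f x)
  ok′ {x} {u} x∈ s a with fiber⁻ x∈
  ... | x∈S , refl = ok (fS s) fa , λ e → ok (fS s) fa (trans (same (fS s) fu≢) e)
    where
    fa = hom s x∈S a
    fu≢ : f u ≢ f x
    fu≢ e = Graph.irrefl H e fa

-- The path on `A` is played while the rest of `S` stands still; this is legal because no outside
-- neighbor of `A` has a color of `L`. Describing `e` and `e′` by their values on the two sides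
-- spares the callers any gluing of colorings.
embed : ∀ {n ℓ} {G : Graph n} {A S : Pred (Fin n) 0ℓ} {L Q : Pred (Fin ℓ) 0ℓ} {κ c d} →
        (∀ v → Dec (A v)) → (∀ {v} → A v → S v) → (∀ {a} → L a → Q a) → ∀ {e e′} →
        (∀ {w x a} → S w → ¬ A w → A x → Graph.Adj G w x → L a → e w ≢ a) →
        (∀ {v} → A v → e v ≡ c v) → (∀ {v} → A v → d v ≡ e′ v) →
        (∀ {v} → S v → ¬ A v → e v ≡ e′ v) →
        Path G A L κ c d → Path G S Q κ e e′
embed A? A⊆S L⊆Q {e} {e′} avail start end off (done eq) = done agree
  where
  agree : ∀ {v} → _ → e v ≡ e′ v
  agree {v} s with A? v
  ... | yes a = trans (start a) (trans (eq a) (end a))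
  ... | no ¬a = off s ¬a
embed {G = G} {A} {S} {L = L} A? A⊆S L⊆Q {e} {e′} avail start end off
  (step {c = c} {c′} x Ax La same ok κx κ≤ p) =
  step x (A⊆S Ax) (L⊆Q (subst L (sym e₁x) La))
    (λ _ u≢x → sym (updateAt-minimal _ x e u≢x))
    ok₁ κx κ≤
    (embed A? A⊆S L⊆Q avail₁ start₁ end off₁ p)
  where
  e₁ = updateAt e x (const (c′ x))
  e₁x : e₁ x ≡ c′ x
  e₁x = updateAt-updates x e
  e₁≡e : ∀ {u} → ¬ A u → e₁ u ≡ e u
  e₁≡e {u} ¬a = updateAt-minimal u x e λ { refl → ¬a Ax }
  ok₁ : ∀ {u} → S u → Graph.Adj G u x → e u ≢ e₁ x
  ok₁ {u} s a eq with A? u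
  ... | yes Au = ok Au a (trans (sym (start Au)) (trans eq e₁x))
  ... | no ¬Au = avail s ¬Au Ax a La (trans eq e₁x)
  avail₁ : ∀ {w y a} → S w → ¬ A w → A y → Graph.Adj G w y → L a → e₁ w ≢ a
  avail₁ s ¬a Ay wy La eq = avail s ¬a Ay wy La (trans (sym (e₁≡e ¬a)) eq)
  start₁ : ∀ {v} → A v → e₁ v ≡ c′ v
  start₁ {v} Av with v ≟ x
  ... | yes refl = e₁x
  ... | no v≢x = trans (updateAt-minimal v x e v≢x) (trans (start Av) (same Av v≢x))
  off₁ : ∀ {v} → S v → ¬ A v → e₁ v ≡ e′ v
  off₁ s ¬a = trans (e₁≡e ¬a) (off s ¬a)

-- Permuting the colors of a clique with one spare color.

K : ∀ m → Graph m
K m = record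
  { Adj = _≢_ ; adj? = λ u v → ¬? (u ≟ v)
  ; sym = λ ne e → ne (sym e) ; irrefl = λ e ne → ne e }

module _ {m ℓ} {L : Pred (Fin ℓ) 0ℓ} (room : Roomy m L)
         (δ : Fin m → Fin ℓ) (δ-inj : Injective _≡_ _≡_ δ) (δL : ∀ i → L (δ i)) where

  private
    KPath : ℕ → (c d : Fin m → Fin ℓ) → Set
    KPath t = Path (K m) U L (const t)

    single : ∀ (γ : Fin m → Fin ℓ) x a → L a → (∀ i → i ≢ x → γ i ≢ a) →
             Path (K m) U L (updateAt (const 0) x (const 1)) γ (updateAt γ x (const a))
    single γ x a La free =
      step {κ = const 0} x _ (subst L (sym γ₁x) La) (λ _ ne → sym (updateAt-minimal _ x γ ne))
        (λ _ ne e → free _ ne (trans e γ₁x))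
        (≤-reflexive (sym (updateAt-updates x (const 0)))) (λ _ → z≤n) (done λ _ → refl)
      where
      γ₁x = updateAt-updates x {const a} γ

    single≤ : ∀ {x i y : Fin m} → y ≢ x →
              updateAt (const 0) y (const 1) i + updateAt (const 0) x (const 1) i ≤ 1
    single≤ {x} {i} {y} y≢x with i ≟ y
    ... | yes refl rewrite updateAt-updates y {const 1} (const 0)
                         | updateAt-minimal y x {const 1} (const 0) y≢x = ≤-refl
    ... | no i≢y rewrite updateAt-minimal i y {const 1} (const 0) i≢y with i ≟ x
    ...   | yes refl = ≤-reflexive (updateAt-updates x (const 0))
    ...   | no i≢x = ≤-trans (≤-reflexive (updateAt-minimal i x (const 0) i≢x)) z≤n

    -- If another vertex `y` holds the color `δ x`, it first steps aside to a color outside the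
    -- image of `γ`. As `y ≢ x`, each vertex moves at most once; injectivity of `δ` shows that `y`
    -- was not settled, so no settled vertex is disturbed.
    settle : ∀ γ → Injective _≡_ _≡_ γ → ∀ x →
             ∃ λ γ′ → KPath 1 γ γ′ × γ′ x ≡ δ x × (∀ i → γ i ≡ δ i → γ′ i ≡ δ i)
    settle γ γ-inj x with any? (λ y → γ y ≟ δ x)
    ... | no ¬y = updateAt γ x (const (δ x))
        , weaken one≤1 (single γ x (δ x) (δL x) (λ i _ e → ¬y (i , e)))
        , updateAt-updates x γ , keep
      where
      one≤1 : ∀ i → updateAt (const 0) x (const 1) i ≤ 1
      one≤1 i with i ≟ x
      ... | yes refl = ≤-reflexive (updateAt-updates x (const 0))
      ... | no i≢x = ≤-trans (≤-reflexive (updateAt-minimal i x (const 0) i≢x)) z≤n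
      keep : ∀ i → γ i ≡ δ i → updateAt γ x (const (δ x)) i ≡ δ i
      keep i e with i ≟ x
      ... | yes refl = updateAt-updates x γ
      ... | no i≢x = trans (updateAt-minimal i x γ i≢x) e
    ... | yes (y , γy) with y ≟ x
    ...   | yes refl = γ , done (λ _ → refl) , γy , λ _ e → e
    ...   | no y≢x with room γ
    ...     | a , La , a-free = γ₂
        , weaken (λ i → single≤ y≢x)
            (single γ y a La (λ i _ → a-free i) ◅◅ single γ₁ x (δ x) (δL x) free)
        , updateAt-updates x γ₁ , keep
      where
      γ₁ = updateAt γ y (const a)
      γ₂ = updateAt γ₁ x (const (δ x))
      free : ∀ i → i ≢ x → γ₁ i ≢ δ x
      free i i≢x e with i ≟ y
      ... | yes refl = a-free y (trans γy (trans (sym e) (updateAt-updates y γ)))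
      ... | no i≢y = i≢y (γ-inj (trans (sym (updateAt-minimal i y γ i≢y)) (trans e (sym γy))))
      keep : ∀ i → γ i ≡ δ i → γ₂ i ≡ δ i
      keep i e with i ≟ x
      ... | yes refl = updateAt-updates x γ₁
      ... | no i≢x = trans (updateAt-minimal i x γ₁ i≢x) (trans (updateAt-minimal i y γ
                       λ { refl → y≢x (δ-inj (trans (sym e) γy)) }) e)

    settleAll : ∀ xs γ → Injective _≡_ _≡_ γ →
                ∃ λ γ′ → KPath (length xs) γ γ′ × (∀ {x} → x ∈ xs → γ′ x ≡ δ x)
                                               × (∀ i → γ i ≡ δ i → γ′ i ≡ δ i)
    settleAll [] γ γ-inj = γ , done (λ _ → refl) , (λ ()) , λ _ e → e
    settleAll (x ∷ xs) γ γ-inj with settle γ γ-inj x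
    ... | γ₁ , p₁ , γ₁x , keep₁ with settleAll xs γ₁ γ₁-inj
      where
      γ₁-inj : Injective _≡_ _≡_ γ₁
      γ₁-inj {i} {j} e with i ≟ j
      ... | yes eq = eq
      ... | no ne = contradiction e
            (path-proper p₁ (λ _ _ ne′ e′ → ne′ (γ-inj e′)) _ _ ne)
    ...   | γ₂ , p₂ , at₂ , keep₂ = γ₂ , p₁ ◅◅ p₂
        , (λ { (here refl) → keep₂ x γ₁x ; (there i) → at₂ i })
        , λ i e → keep₂ i (keep₁ i e)

  -- Settling the vertices one after another, each settled vertex displaces at
  -- most one unsettled vertex; hence at most m moves per vertex.
  permute : ∀ γ → Injective _≡_ _≡_ γ → Path (K m) U L (const m) γ δ
  permute γ γ-inj with settleAll (allFin m) γ γ-inj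
  ... | γ′ , p , at , _ = weaken (λ _ → ≤-reflexive (length-tabulate id))
                            (retarget p (λ {v} _ → at (∈-allFin v)))

-- Retractions onto cliques, and folding a dominated set.

lookup-injective : ∀ {A : Set} {xs : List A} → Unique xs → Injective _≡_ _≡_ (lookup xs)
lookup-injective (x∉ ∷ xs!) {zero}  {zero}  _  = refl
lookup-injective (x∉ ∷ xs!) {zero}  {suc j} eq = contradiction eq (All.lookup x∉ (∈-lookup j))
lookup-injective (x∉ ∷ xs!) {suc i} {zero}  eq = contradiction (sym eq) (All.lookup x∉ (∈-lookup i))
lookup-injective (x∉ ∷ xs!) {suc i} {suc j} eq = cong suc (lookup-injective xs! eq)

module _ {n} (G : Graph n) where
  open Graph G using (Adj)
  open DecMembership (_≟_ {n}) using (_∈?_)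

  -- One notion for both reductions. For nonadjacent singletons it is inclusion of neighborhoods
  -- within `S`; for two anticomplete modules with the same neighbors it holds in both directions.
  record Dominated (S A B : List (Fin n)) : Set where
    field
      A⊆   : ∀ {a} → a ∈ A → a ∈ S
      B⊆   : ∀ {b} → b ∈ B → b ∈ S
      a₀   : Fin n
      a₀∈  : a₀ ∈ A
      b₀   : Fin n
      b₀∈  : b₀ ∈ B
      apart : ∀ {a b} → a ∈ A → b ∈ B → a ≢ b × ¬ Adj a b
      dom  : ∀ {w a} → w ∈ S → w ∉ A → a ∈ A → Adj w a →
             (∀ {x} → x ∈ A → Adj w x) × (∀ {b} → b ∈ B → Adj w b)

  length-filter-split : ∀ (A xs : List (Fin n)) →
    length (filter (_∈? A) xs) + length (filter (λ x → ¬? (x ∈? A)) xs) ≡ length xs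
  length-filter-split A [] = refl
  length-filter-split A (x ∷ xs) with x ∈? A
  ... | yes _ = cong suc (length-filter-split A xs)
  ... | no _ = trans (+-suc _ _) (cong suc (length-filter-split A xs))

module _ {n} (G : Graph n) (ℓ : ℕ) where
  open Graph G using (Adj; irrefl) renaming (sym to Adj-sym)
  open DecMembership (_≟_ {n}) using (_∈?_)

  -- The induction invariant. `L` is arbitrary because a folded set may only use colors that its
  -- outside neighbors avoid. The bound is on `t + m` because folding spends `t` moves on reaching
  -- the clique coloring and `m` more on permuting its colors.
  record Good (S : List (Fin n)) : Set₁ where
    field
      m t    : ℕ
      k      : Fin m → Fin n
      k∈     : ∀ i → k i ∈ S
      k-adj  : ∀ {i j} → i ≢ j → Adj (k i) (k j)
      ρ      : Fin n → Fin m
      ρ-k    : ∀ i → ρ (k i) ≡ i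
      ρ-adj  : ∀ {u v} → u ∈ S → v ∈ S → Adj u v → ρ u ≢ ρ v
      t+m≤   : t + m ≤ length S
      reach  : ∀ {L : Pred (Fin ℓ) 0ℓ} → Roomy m L → ∀ {c} → ProperOn G (_∈ S) c →
               (∀ {v} → v ∈ S → L (c v)) →
               ∃ λ γ → Path G (_∈ S) L (const t) c (γ ∘ ρ)

  good-complete : ∀ {S x} → x ∈ S → Unique S →
                  (∀ {u v} → u ∈ S → v ∈ S → u ≢ v → Adj u v) → Good S
  good-complete {S} {x} x∈ S! complete = record
    { m = length S ; t = 0 ; k = lookup S ; k∈ = ∈-lookup
    ; k-adj = λ {i} {j} i≢j → complete (∈-lookup i) (∈-lookup j) (i≢j ∘ lookup-injective S!)
    ; ρ = ρ ; ρ-k = λ i → lookup-injective S! (k-ρ (∈-lookup i))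
    ; ρ-adj = λ u∈ v∈ uv e → irrefl (trans (sym (k-ρ u∈)) (trans (cong (lookup S) e) (k-ρ v∈))) uv
    ; t+m≤ = ≤-refl
    ; reach = λ _ {c} _ _ → c ∘ lookup S , done (λ v∈ → cong c (sym (k-ρ v∈)))
    }
    where
    ρ : Fin n → Fin (length S)
    ρ u with u ∈? S
    ... | yes u∈ = Any.index u∈
    -- A default outside `S`, available because `S` has the member `x`.
    ... | no _ = Any.index x∈
    k-ρ : ∀ {u} → u ∈ S → lookup S (ρ u) ≡ u
    k-ρ {u} u∈ with u ∈? S
    ... | yes p = sym (lookup-index p)
    ... | no ¬p = contradiction u∈ ¬p

  k-injective : ∀ {S} (g : Good S) {p} (c : Fin n → Fin p) → ProperOn G (_∈ S) c →
                Injective _≡_ _≡_ (c ∘ Good.k {S} g)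
  k-injective g c pc {i} {j} e with i ≟ j
  ... | yes eq = eq
  ... | no ne = contradiction e (pc (Good.k∈ g i) (Good.k∈ g j) (Good.k-adj g ne))

  proper-⊆ : ∀ {S A : List (Fin n)} {c : Fin n → Fin ℓ} → (∀ {a} → a ∈ A → a ∈ S) →
             ProperOn G (_∈ S) c → ProperOn G (_∈ A) c
  proper-⊆ A⊆ pc a b = pc (A⊆ a) (A⊆ b)

  module Fold {S A B : List (Fin n)} (S! : Unique S) (A! : Unique A) (D : Dominated G S A B)
              (gA : Good A) (gB : Good B) (mA≤mB : Good.m gA ≤ Good.m gB) where
    open Dominated D
    open Good gA using () renaming (m to mA; t to tA; ρ to ρA)
    open Good gB using () renaming (m to mB; k to kB)

    fold : Fin n → Fin n
    fold u with u ∈? A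
    ... | yes _ = kB (inject≤ (ρA u) mA≤mB)
    ... | no _ = u

    fold-A : ∀ {u} → u ∈ A → fold u ≡ kB (inject≤ (ρA u) mA≤mB)
    fold-A {u} u∈ with u ∈? A
    ... | yes _ = refl
    ... | no u∉ = contradiction u∈ u∉

    fold-∉ : ∀ {u} → u ∉ A → fold u ≡ u
    fold-∉ {u} u∉ with u ∈? A
    ... | yes u∈ = contradiction u∈ u∉
    ... | no _ = refl

    B∩A : ∀ {b} → b ∈ B → b ∉ A
    B∩A b∈ b∈A = proj₁ (apart b∈A b∈) refl

    -- An edge leaving `A` survives because its outer end is complete to `B`. The map is a parameter
    -- since both `fold` and the color-preserving `g` are of this kind.
    retraction-hom : ∀ (f : Fin n → Fin n) →
      (∀ {u} → u ∈ A → f u ∈ B) → (∀ {u} → u ∉ A → f u ≡ u) →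
      (∀ {u v} → u ∈ A → v ∈ A → Adj u v → Adj (f u) (f v)) →
      ∀ {u v} → u ∈ S → v ∈ S → Adj u v → Adj (f u) (f v)
    retraction-hom f fA f∉ homA {u} {v} u∈ v∈ uv with u ∈? A | v ∈? A
    ... | yes a | yes b = homA a b uv
    ... | yes a | no b rewrite f∉ b = Adj-sym (proj₂ (dom v∈ b a (Adj-sym uv)) (fA a))
    ... | no a | yes b rewrite f∉ a = proj₂ (dom u∈ a b uv) (fA b)
    ... | no a | no b rewrite f∉ a | f∉ b = uv

    fold-B : ∀ {u} → u ∈ A → fold u ∈ B
    fold-B u∈ rewrite fold-A u∈ = Good.k∈ gB _

    fold-hom : ∀ {u v} → u ∈ S → v ∈ S → Adj u v → Adj (fold u) (fold v)
    fold-hom = retraction-hom fold fold-B fold-∉ homA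
      where
      homA : ∀ {u v} → u ∈ A → v ∈ A → Adj u v → Adj (fold u) (fold v)
      homA u∈ v∈ uv rewrite fold-A u∈ | fold-A v∈ =
        Good.k-adj gB (Good.ρ-adj gA u∈ v∈ uv ∘ inject≤-injective _ _ _ _)

    -- Together with `a`, the colors on the clique of `B` give `A` at least `mB + 1 > mA` colors. So
    -- `A` can be brought to a coloring through its own clique, whose colors are then permuted to
    -- their targets; this costs `tA + mA` moves, at most `length A`.
    align : ∀ {Q : Pred (Fin ℓ) 0ℓ} {c a} → ProperOn G (_∈ S) c → (∀ {v} → v ∈ S → Q (c v)) →
            Q a → (∀ {w u} → w ∈ S → w ∉ A → u ∈ A → Adj w u → c w ≢ a) → (∀ i → c (kB i) ≢ a) →
            Path G (_∈ S) Q (const (length A)) c (c ∘ fold)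
    align {Q} {c} {a} pc cQ Qa avail fresh =
      embed (_∈? A) A⊆ proj₁ (λ s ¬a Ax wx La → proj₂ La s ¬a Ax wx) (λ _ → refl)
        (λ u∈ → cong c (sym (fold-A u∈))) (λ _ u∉ → cong c (sym (fold-∉ u∉)))
        (weaken (λ _ → Good.t+m≤ gA) (proj₂ reached ◅◅ lift A! ρA _ (Good.ρ-adj gA) permuted))
      where
      -- The colors that `A` may use while the rest of `S` is fixed.
      L : Pred (Fin ℓ) 0ℓ
      L x = Q x × (∀ {w u} → w ∈ S → w ∉ A → u ∈ A → Adj w u → c w ≢ x)
      h : Fin (suc mB) → Fin ℓ
      h zero = a
      h (suc i) = c (kB i)
      h-inj : Injective _≡_ _≡_ h
      h-inj {zero} {zero} _ = refl
      h-inj {zero} {suc j} e = contradiction (sym e) (fresh j)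
      h-inj {suc i} {zero} e = contradiction e (fresh i)
      h-inj {suc i} {suc j} e = cong suc (k-injective gB c (proper-⊆ B⊆ pc) e)
      -- A neighbor of `A` outside `A` is also adjacent to the whole clique of `B`, hence avoids its
      -- colors.
      kB-L : ∀ i → L (c (kB i))
      kB-L i = cQ (B⊆ (Good.k∈ gB i)) ,
        λ w∈ w∉ u∈ wu → pc w∈ (B⊆ (Good.k∈ gB i)) (proj₂ (dom w∈ w∉ u∈ wu) (Good.k∈ gB i))
      hL : ∀ i → L (h i)
      hL zero = Qa , avail
      hL (suc i) = kB-L i
      room : Roomy mA L
      room = roomy h h-inj hL (s≤s mA≤mB)
      reached : ∃ λ γ → Path G (_∈ A) L (const tA) c (γ ∘ ρA)
      reached = Good.reach gA room (proper-⊆ A⊆ pc)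
        λ v∈ → cQ (A⊆ v∈) , λ w∈ w∉ u∈ wu → pc w∈ (A⊆ v∈) (proj₁ (dom w∈ w∉ u∈ wu) v∈)
      γ = proj₁ reached
      γ-inj : Injective _≡_ _≡_ γ
      γ-inj {i} {j} e = k-injective gA (γ ∘ ρA) (path-proper (proj₂ reached) (proper-⊆ A⊆ pc))
        (trans (cong γ (Good.ρ-k gA i)) (trans e (cong γ (sym (Good.ρ-k gA j)))))
      permuted : Path (K mA) U L (const mA) γ (λ i → c (kB (inject≤ i mA≤mB)))
      permuted = permute room _
        (inject≤-injective mA≤mB mA≤mB _ _ ∘ k-injective gB c (proper-⊆ B⊆ pc))
        (λ i → kB-L _) γ γ-inj

    module _ {S′ : List (Fin n)} (S′⁺ : ∀ {u} → u ∈ S → u ∉ A → u ∈ S′)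
             (S′⁻ : ∀ {u} → u ∈ S′ → u ∈ S × u ∉ A)
             (size : length A + length S′ ≤ length S) (g′ : Good S′) where
      open Good g′ renaming (m to m′; t to t′; k to k′; ρ to ρ′)

      into-S′ : ∀ (f : Fin n → Fin n) → (∀ {u} → u ∈ A → f u ∈ B) → (∀ {u} → u ∉ A → f u ≡ u) →
                ∀ {u} → u ∈ S → f u ∈ S′
      into-S′ f fA f∉ {u} u∈ with u ∈? A
      ... | yes a = S′⁺ (B⊆ (fA a)) (B∩A (fA a))
      ... | no a rewrite f∉ a = S′⁺ u∈ a

      reachS : ∀ {Q : Pred (Fin ℓ) 0ℓ} → Roomy m′ Q → ∀ {c} → ProperOn G (_∈ S) c →
               (∀ {v} → v ∈ S → Q (c v)) →
               ∃ λ γ → Path G (_∈ S) Q (const (length A + t′)) c (γ ∘ ρ′ ∘ fold)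
      reachS {Q} room {c} pc cQ
        with Good.reach g′ room (proper-⊆ (proj₁ ∘ S′⁻) pc) (λ v∈ → cQ (proj₁ (S′⁻ v∈)))
           | any? (λ u → (u ∈? A) ×-dec all? (λ i → ¬? (c (kB i) ≟ c u)))
      -- The color of `u` is the extra color: every outside neighbor of `A` is adjacent to `u` and
      -- so avoids it.
      ... | γ , p | yes (u , u∈ , fresh) = γ ,
        (align pc cQ (cQ (A⊆ u∈))
           (λ w∈ w∉ x∈ wx → pc w∈ (A⊆ u∈) (proj₁ (dom w∈ w∉ x∈ wx) u∈)) fresh
         ◅◅ lift S! fold (into-S′ fold fold-B fold-∉) fold-hom p)
      ... | γ , p | no ¬fresh = γ , weaken (λ _ → ≤-reflexive (+-comm t′ (length A)))
            (lifted ◅◅ retarget aligned g∘fold)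
        where
        copy : ∀ u → ∃ λ v → u ∈ A → v ∈ B × (∃ λ i → v ≡ kB i) × c v ≡ c u
        copy u with any? (λ i → c (kB i) ≟ c u)
        ... | yes (i , e) = kB i , λ _ → Good.k∈ gB i , (i , refl) , e
        -- A placeholder for vertices outside `A`: for `u` in `A`, `¬i` would make the color of `u`
        -- fresh.
        ... | no ¬i = u , λ u∈ → contradiction (u , u∈ , λ i e → ¬i (i , e)) ¬fresh
        g : Fin n → Fin n
        g u with u ∈? A
        ... | yes _ = proj₁ (copy u)
        ... | no _ = u
        g-∉ : ∀ {u} → u ∉ A → g u ≡ u
        g-∉ {u} u∉ with u ∈? A
        ... | yes u∈ = contradiction u∈ u∉
        ... | no _ = refl
        g-A : ∀ {u} → u ∈ A → g u ∈ B × (∃ λ i → g u ≡ kB i) × c (g u) ≡ c u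
        g-A {u} u∈ with u ∈? A
        ... | yes a = proj₂ (copy u) a
        ... | no u∉ = contradiction u∈ u∉
        homA : ∀ {u v} → u ∈ A → v ∈ A → Adj u v → Adj (g u) (g v)
        homA u∈ v∈ uv with g-A u∈ | g-A v∈
        ... | _ , (i , ei) , cu | _ , (j , ej) , cv rewrite ei | ej =
          Good.k-adj gB λ { refl → pc (A⊆ u∈) (A⊆ v∈) uv (trans (sym cu) cv) }
        c≗c∘g : ∀ {u} → u ∈ S → c u ≡ c (g u)
        c≗c∘g {u} _ with u ∈? A
        ... | no _ = refl
        ... | yes a = sym (proj₂ (proj₂ (proj₂ (copy u) a)))
        lifted : Path G (_∈ S) Q (const t′) c (γ ∘ ρ′ ∘ g)
        lifted = reset c≗c∘g (λ _ → ≤-refl) (lift S! g (into-S′ g (proj₁ ∘ g-A) g-∉)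
                   (retraction-hom g (proj₁ ∘ g-A) g-∉ homA) p)
        -- A color outside the image of `γ` is absent from the whole coloring reached by `lifted`.
        spare = room γ
        aligned : Path G (_∈ S) Q (const (length A)) (γ ∘ ρ′ ∘ g) (γ ∘ ρ′ ∘ g ∘ fold)
        aligned = align (path-proper lifted pc) (path-colors lifted cQ) (proj₁ (proj₂ spare))
          (λ _ _ _ _ → proj₂ (proj₂ spare) _) (λ _ → proj₂ (proj₂ spare) _)
        -- The image of `fold` avoids `A`, and `g` is the identity there.
        g∘fold : ∀ {u} → u ∈ S → γ (ρ′ (g (fold u))) ≡ γ (ρ′ (fold u))
        g∘fold u∈ = cong (γ ∘ ρ′) (g-∉ (proj₂ (S′⁻ (into-S′ fold fold-B fold-∉ u∈))))

      good-fold : Good S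
      good-fold = record
        { m = m′ ; t = length A + t′ ; k = k′
        ; k∈ = λ i → proj₁ (S′⁻ (Good.k∈ g′ i)) ; k-adj = Good.k-adj g′
        ; ρ = ρ′ ∘ fold
        ; ρ-k = λ i → trans (cong ρ′ (fold-∉ (proj₂ (S′⁻ (Good.k∈ g′ i))))) (Good.ρ-k g′ i)
        ; ρ-adj = λ u∈ v∈ uv → Good.ρ-adj g′ (into-S′ fold fold-B fold-∉ u∈)
                    (into-S′ fold fold-B fold-∉ v∈) (fold-hom u∈ v∈ uv)
        ; t+m≤ = ≤-trans (≤-reflexive (+-assoc (length A) t′ m′))
                   (≤-trans (+-monoʳ-≤ (length A) (Good.t+m≤ g′)) size)
        ; reach = reachS
        }

-- Induced subgraphs and the structure of the graph class.

module _ {n} (G : Graph n) where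
  open Graph G using (Adj; adj?; irrefl) renaming (sym to Adj-sym)
  open DecMembership (_≟_ {n}) using (_∈?_)

  Apart : Fin n → Fin n → Set
  Apart u v = u ≢ v × ¬ Adj u v

  -- Indexed by a Boolean so that for a concrete `H` each premise of `induced` computes to `Adj` or
  -- `Apart`. Either one implies distinctness, which makes the copy injective.
  Agrees : Bool → Fin n → Fin n → Set
  Agrees true  = Adj
  Agrees false = Apart

  module _ (H : Graph 5) (a b c d e : Fin n) where
    private
      f : Fin 5 → Fin n
      f = Vec.lookup (a ∷ b ∷ c ∷ d ∷ e ∷ [])

      Match : Fin 5 → Fin 5 → Set
      Match i j = Agrees (does (Graph.adj? H i j)) (f i) (f j)

      Same : Fin 5 → Fin 5 → Set
      Same i j = (f i ≡ f j → i ≡ j) × (Graph.Adj H i j ⇔ Adj (f i) (f j))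

      same-refl : ∀ i → Same i i
      same-refl i = (λ _ → refl) ,
        mk⇔ (λ p → contradiction p (Graph.irrefl H refl)) (λ p → contradiction p (irrefl refl))

      same : ∀ {i j} → Match i j → Same i j
      same {i} {j} m with Graph.adj? H i j
      ... | yes ij = (λ e → contradiction m (irrefl e)) , mk⇔ (const m) (const ij)
      ... | no ¬ij = (λ e → contradiction e (proj₁ m)) ,
                     mk⇔ (λ p → contradiction p ¬ij) (λ p → contradiction p (proj₂ m))

      same-sym : ∀ {i j} → Same i j → Same j i
      same-sym (inj , eqv) = (λ e → sym (inj (sym e))) ,
        mk⇔ (Adj-sym ∘ Equivalence.to eqv ∘ Graph.sym H) (Graph.sym H ∘ Equivalence.from eqv ∘ Adj-sym)

    induced : Match (# 0) (# 1) → Match (# 0) (# 2) → Match (# 0) (# 3) → Match (# 0) (# 4) →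
              Match (# 1) (# 2) → Match (# 1) (# 3) → Match (# 1) (# 4) →
              Match (# 2) (# 3) → Match (# 2) (# 4) → Match (# 3) (# 4) → InducedCopy H G
    induced m01 m02 m03 m04 m12 m13 m14 m23 m24 m34 = record
      { f = f ; injective = λ {i} {j} → proj₁ (all-same i j) ; adj⇔ = λ i j → proj₂ (all-same i j) }
      where
      upper : ∀ i j → i Fin.< j → Match i j
      upper zero (suc zero) _ = m01
      upper zero (suc (suc zero)) _ = m02
      upper zero (suc (suc (suc zero))) _ = m03
      upper zero (suc (suc (suc (suc zero)))) _ = m04
      upper (suc zero) (suc (suc zero)) _ = m12
      upper (suc zero) (suc (suc (suc zero))) _ = m13
      upper (suc zero) (suc (suc (suc (suc zero)))) _ = m14
      upper (suc (suc zero)) (suc (suc (suc zero))) _ = m23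
      upper (suc (suc zero)) (suc (suc (suc (suc zero)))) _ = m24
      upper (suc (suc (suc zero))) (suc (suc (suc (suc zero)))) _ = m34
      upper (suc _) (suc zero) (s≤s ())
      upper (suc (suc _)) (suc (suc zero)) (s≤s (s≤s ()))
      upper (suc (suc (suc _))) (suc (suc (suc zero))) (s≤s (s≤s (s≤s ())))
      upper (suc (suc (suc (suc _)))) (suc (suc (suc (suc zero)))) (s≤s (s≤s (s≤s (s≤s ()))))
      all-same : ∀ i j → Same i j
      all-same i j with <-cmp i j
      ... | tri< i<j _ _ = same (upper i j i<j)
      ... | tri≈ _ refl _ = same-refl i
      ... | tri> _ _ j<i = same-sym (same (upper j i j<i))

  -- Connectedness of the induced subgraph as an induction principle along its edges; `spread`
  -- applies it to the property of being adjacent to `v`.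
  Connects : List (Fin n) → Set₁
  Connects A = ∀ (P : Pred (Fin n) 0ℓ) {x} → x ∈ A → P x →
               (∀ {y z} → y ∈ A → z ∈ A → Adj y z → P y → P z) → ∀ {z} → z ∈ A → P z

  record Block (A : List (Fin n)) : Set₁ where
    field
      point    : Fin n
      point∈   : point ∈ A
      neighbor : ∀ {a} → a ∈ A → ∃ λ a′ → a′ ∈ A × Adj a a′
      connects : Connects A

  edge-block : ∀ {x y} → Adj x y → Block (x ∷ y ∷ [])
  edge-block {x} {y} xy = record
    { point = x ; point∈ = here refl
    ; neighbor = λ { (here refl) → y , there (here refl) , xy
                   ; (there (here refl)) → x , here refl , Adj-sym xy }
    ; connects = conn }
    where
    conn : Connects (x ∷ y ∷ [])
    conn P (here refl) Px cl (here refl) = Px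
    conn P (here refl) Px cl (there (here refl)) = cl (here refl) (there (here refl)) xy Px
    conn P (there (here refl)) Px cl (here refl) = cl (there (here refl)) (here refl) (Adj-sym xy) Px
    conn P (there (here refl)) Px cl (there (here refl)) = Px

  extend-block : ∀ {A v a} → Block A → a ∈ A → Adj v a → Block (v ∷ A)
  extend-block {A} {v} {a} bA a∈ va = record
    { point = v ; point∈ = here refl
    ; neighbor = λ { (here refl) → a , there a∈ , va
                   ; (there x∈) → let y , y∈ , xy = Block.neighbor bA x∈ in y , there y∈ , xy }
    ; connects = conn }
    where
    conn : Connects (v ∷ A)
    conn P {x} x∈ Px cl = all
      where
      within : ∀ {x} → x ∈ A → P x → ∀ {z} → z ∈ A → P z
      within x∈ Px = Block.connects bA P x∈ Px λ y∈ z∈ → cl (there y∈) (there z∈)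
      Pa : ∀ {x} → x ∈ v ∷ A → P x → P a
      Pa (here refl) Px = cl (here refl) (there a∈) va Px
      Pa (there x∈) Px = within x∈ Px a∈
      all : ∀ {z} → z ∈ v ∷ A → P z
      all (here refl) = cl (there a∈) (here refl) (Adj-sym va) (Pa x∈ Px)
      all (there z∈) = within a∈ (Pa x∈ Px) z∈

  AllApart : List (Fin n) → List (Fin n) → Set
  AllApart A B = ∀ {a b} → a ∈ A → b ∈ B → Apart a b

  apart-sym : ∀ {u v} → Apart u v → Apart v u
  apart-sym (ne , na) = ≢-sym ne , na ∘ Adj-sym

  Edgeless : List (Fin n) → Set
  Edgeless A = ∀ {x y} → x ∈ A → y ∈ A → ¬ Adj x y

  module _ (noP₅ : (P₅ -Free) G) (noCoBanner : (coBanner -Free) G) where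

    -- Suppose `v` sees `y` but not `z` for an edge `yz` of `A`, and take a neighbor `b′` of `b` in
    -- `B`. If `v` sees `b′`, the triangle `b b′ v` with the tail `v y z` is a co-banner; otherwise
    -- `z y v b b′` is an induced path.
    spread : ∀ {A B v a b} → Block A → Block B → AllApart A B → v ∉ A → v ∉ B →
             a ∈ A → Adj v a → b ∈ B → Adj v b → ∀ {z} → z ∈ A → Adj v z
    spread {A} {B} {v} {a} {b} bA bB apart v∉A v∉B a∈ va b∈ vb =
      Block.connects bA (Adj v) a∈ va next
      where
      next : ∀ {y z} → y ∈ A → z ∈ A → Adj y z → Adj v y → Adj v z
      next {y} {z} y∈ z∈ yz vy with adj? v z | Block.neighbor bB b∈
      ... | yes vz | _ = vz
      ... | no ¬vz | b′ , b′∈ , bb′ with adj? v b′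
      ...   | yes vb′ = contradiction
              (induced coBanner b b′ v y z
                bb′ (Adj-sym vb) (apart-sym (apart y∈ b∈)) (apart-sym (apart z∈ b∈))
                (Adj-sym vb′) (apart-sym (apart y∈ b′∈)) (apart-sym (apart z∈ b′∈))
                vy ((λ { refl → v∉A z∈ }) , ¬vz) yz)
              noCoBanner
      ...   | no ¬vb′ = contradiction
              (induced P₅ z y v b b′
                (Adj-sym yz) ((λ { refl → v∉A z∈ }) , ¬vz ∘ Adj-sym) (apart z∈ b∈) (apart z∈ b′∈)
                (Adj-sym vy) (apart y∈ b∈) (apart y∈ b′∈)
                vb ((λ { refl → v∉B b′∈ }) , ¬vb′) bb′)
              noP₅

    -- Vertices with neighbors in exactly one of the two blocks are absorbed
    -- into it; when none is left, both blocks are modules.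
    grow : ∀ N {S A B} R → length R ≤ N → Block A → Block B → AllApart A B →
           (∀ {a} → a ∈ A → a ∈ S) → (∀ {b} → b ∈ B → b ∈ S) → (∀ {r} → r ∈ R → r ∈ S) →
           (∀ {w} → w ∈ S → w ∈ A ⊎ w ∈ B ⊎ w ∈ R) →
           ∃₂ λ A B → Dominated G S A B × Dominated G S B A
    grow N {S} {A} {B} R R≤N bA bB apart A⊆ B⊆ R⊆ cover
      with Any.any? (λ v → Any.any? (adj? v) A ×-dec ¬? (Any.any? (adj? v) B)) R
         | Any.any? (λ v → Any.any? (adj? v) B ×-dec ¬? (Any.any? (adj? v) A)) R
    grow zero [] z≤n _ _ _ _ _ _ _ | yes () | _
    grow zero [] z≤n _ _ _ _ _ _ _ | _ | yes ()
    grow (suc N) {S} {A} {B} R R≤N bA bB apart A⊆ B⊆ R⊆ cover | yes found | _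
      with find found
    ... | v , v∈ , vA , v¬B with find vA
    ...   | a , a∈ , va =
      grow N (filter (λ w → ¬? (w ≟ v)) R)
        (s≤s⁻¹ (≤-trans (filter-notAll (λ w → ¬? (w ≟ v)) R (lose v∈ (λ ne → ne refl))) R≤N))
        (extend-block bA a∈ va) bB
        (λ { (here refl) b∈ → (λ { refl → proj₂ (apart a∈ b∈) (Adj-sym va) }) , (λ vb → v¬B (lose b∈ vb))
           ; (there x∈) b∈ → apart x∈ b∈ })
        (λ { (here refl) → R⊆ v∈ ; (there x∈) → A⊆ x∈ }) B⊆
        (λ r∈ → R⊆ (proj₁ (∈-filter⁻ (λ w → ¬? (w ≟ v)) r∈)))
        cover′
      where
      cover′ : ∀ {w} → w ∈ S → w ∈ v ∷ A ⊎ w ∈ B ⊎ w ∈ filter (λ w → ¬? (w ≟ v)) R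
      cover′ {w} w∈ with cover w∈ | w ≟ v
      ... | _ | yes refl = inj₁ (here refl)
      ... | inj₁ a | no _ = inj₁ (there a)
      ... | inj₂ (inj₁ b) | no _ = inj₂ (inj₁ b)
      ... | inj₂ (inj₂ r) | no ne = inj₂ (inj₂ (∈-filter⁺ (λ w → ¬? (w ≟ v)) r ne))
    grow (suc N) {S} {A} {B} R R≤N bA bB apart A⊆ B⊆ R⊆ cover | no _ | yes found
      with find found
    ... | v , v∈ , vB , v¬A with find vB
    ...   | b , b∈ , vb =
      -- The blocks trade places, which the symmetric conclusion permits.
      grow N (filter (λ w → ¬? (w ≟ v)) R)
        (s≤s⁻¹ (≤-trans (filter-notAll (λ w → ¬? (w ≟ v)) R (lose v∈ (λ ne → ne refl))) R≤N))
        (extend-block bB b∈ vb) bA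
        (λ { (here refl) a∈ → (λ { refl → proj₂ (apart a∈ b∈) vb }) , (λ va → v¬A (lose a∈ va))
           ; (there x∈) a∈ → apart-sym (apart a∈ x∈) })
        (λ { (here refl) → R⊆ v∈ ; (there x∈) → B⊆ x∈ }) A⊆
        (λ r∈ → R⊆ (proj₁ (∈-filter⁻ (λ w → ¬? (w ≟ v)) r∈)))
        cover′
      where
      cover′ : ∀ {w} → w ∈ S → w ∈ v ∷ B ⊎ w ∈ A ⊎ w ∈ filter (λ w → ¬? (w ≟ v)) R
      cover′ {w} w∈ with cover w∈ | w ≟ v
      ... | _ | yes refl = inj₁ (here refl)
      ... | inj₁ a | no _ = inj₂ (inj₁ a)
      ... | inj₂ (inj₁ b) | no _ = inj₁ (there b)
      ... | inj₂ (inj₂ r) | no ne = inj₂ (inj₂ (∈-filter⁺ (λ w → ¬? (w ≟ v)) r ne))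
    grow N {S} {A} {B} R R≤N bA bB apart A⊆ B⊆ R⊆ cover | no noA | no noB =
      A , B , dominated bA bB apart A⊆ B⊆ noA cover
            , dominated bB bA (λ b∈ a∈ → apart-sym (apart a∈ b∈)) B⊆ A⊆ noB swapped
      where
      swapped : ∀ {w} → w ∈ S → w ∈ B ⊎ w ∈ A ⊎ w ∈ R
      swapped w∈ with cover w∈
      ... | inj₁ a = inj₂ (inj₁ a)
      ... | inj₂ (inj₁ b) = inj₁ b
      ... | inj₂ (inj₂ r) = inj₂ (inj₂ r)
      dominated : ∀ {A B} → Block A → Block B → AllApart A B →
        (∀ {a} → a ∈ A → a ∈ S) → (∀ {b} → b ∈ B → b ∈ S) →
        ¬ Any (λ v → Any (Adj v) A × ¬ Any (Adj v) B) R →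
        (∀ {w} → w ∈ S → w ∈ A ⊎ w ∈ B ⊎ w ∈ R) → Dominated G S A B
      dominated {A} {B} bA bB apart A⊆ B⊆ noA cover = record
        { A⊆ = A⊆ ; B⊆ = B⊆ ; a₀ = Block.point bA ; a₀∈ = Block.point∈ bA
        ; b₀ = Block.point bB ; b₀∈ = Block.point∈ bB ; apart = apart ; dom = dom }
        where
        dom : ∀ {w a} → w ∈ S → w ∉ A → a ∈ A → Adj w a →
              (∀ {x} → x ∈ A → Adj w x) × (∀ {b} → b ∈ B → Adj w b)
        dom {w} {a} w∈ w∉A a∈ wa with cover w∈
        ... | inj₁ w∈A = contradiction w∈A w∉A
        ... | inj₂ (inj₁ w∈B) = contradiction (Adj-sym wa) (proj₂ (apart a∈ w∈B))
        ... | inj₂ (inj₂ w∈R) with Any.any? (adj? w) B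
        ...   | no ¬wB = contradiction (lose w∈R (lose a∈ wa , ¬wB)) noA
        ...   | yes wB with find wB
        ...     | b , b∈ , wb =
          spread bA bB apart w∉A w∉B a∈ wa b∈ wb ,
          spread bB bA (λ b∈ a∈ → apart-sym (apart a∈ b∈)) w∉B w∉A b∈ wb a∈ wa
          where
          w∉B : w ∉ B
          w∉B w∈B = proj₂ (apart a∈ w∈B) (Adj-sym wa)

    -- Folding `A` requires that its clique be no larger than that of `B`. Either the roles can be
    -- exchanged, or `A` is edgeless and its clique has at most one vertex.
    Structure : List (Fin n) → Set
    Structure S = ∃₂ λ A B → Dominated G S A B × (Dominated G S B A ⊎ Edgeless A)

    from-2K₂ : ∀ {S a b c d} → a ∈ S → b ∈ S → c ∈ S → d ∈ S → Adj a b → Adj c d →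
               Apart a c → Apart a d → Apart b c → Apart b d → Structure S
    from-2K₂ {S} a∈ b∈ c∈ d∈ ab cd ac ad bc bd
      -- With `S` itself as the remainder, members of a block are absorbed into it again;
      -- `dominated-filter` later removes the repetitions.
      with grow (length S) {S} S ≤-refl (edge-block ab) (edge-block cd)
             (λ { (here refl) (here refl) → ac ; (here refl) (there (here refl)) → ad
                ; (there (here refl)) (here refl) → bc ; (there (here refl)) (there (here refl)) → bd })
             (λ { (here refl) → a∈ ; (there (here refl)) → b∈ })
             (λ { (here refl) → c∈ ; (there (here refl)) → d∈ })
             id (inj₂ ∘ inj₂)
    ... | A , B , AB , BA = A , B , AB , inj₁ BA

    module _ (noC₅ : (C₅ -Free) G) (noHouse : (house -Free) G) where

      structure : ∀ S → (∀ {u v} → u ∈ S → v ∈ S → u ≢ v → Adj u v) ⊎ Structure S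
      structure S with any? (λ u → any? (λ v → (u ∈? S) ×-dec (v ∈? S) ×-dec ¬? (u ≟ v) ×-dec
                         ¬? (adj? u v) ×-dec all? (λ w → (w ∈? S) →-dec (adj? w u →-dec adj? w v))))
      ... | yes (u , v , u∈ , v∈ , u≢v , ¬uv , N⊆) = inj₂ (u ∷ [] , v ∷ [] , record
          { A⊆ = λ { (here refl) → u∈ } ; B⊆ = λ { (here refl) → v∈ }
          ; a₀ = u ; a₀∈ = here refl ; b₀ = v ; b₀∈ = here refl
          ; apart = λ { (here refl) (here refl) → u≢v , ¬uv }
          ; dom = λ { w∈ _ (here refl) wu → (λ { (here refl) → wu }) , λ { (here refl) → N⊆ _ w∈ wu } }
          } , inj₂ (λ { (here refl) (here refl) → irrefl refl }))
      ... | no ¬fold with any? (λ u → any? (λ v → (u ∈? S) ×-dec (v ∈? S) ×-dec ¬? (u ≟ v) ×-dec ¬? (adj? u v)))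
      ...   | no ¬pair = inj₁ λ {u} {v} u∈ v∈ u≢v →
                decidable-stable (adj? u v) λ ¬uv → ¬pair (u , v , u∈ , v∈ , u≢v , ¬uv)
      ...   | yes (u , v , u∈ , v∈ , u≢v , ¬uv) = inj₂ main
        where
        -- The failed search `¬fold` refutes the inclusion of neighborhoods, and decidability over a
        -- finite set turns this into a witness.
        private-neighbor : ∀ {u v} → u ∈ S → v ∈ S → Apart u v →
                           ∃ λ w → w ∈ S × Adj w u × Apart w v
        private-neighbor {u} {v} u∈ v∈ (u≢v , ¬uv)
          with ¬∀⟶∃¬ n _ (λ w → (w ∈? S) →-dec (adj? w u →-dec adj? w v))
                 (λ N⊆ → ¬fold (u , v , u∈ , v∈ , u≢v , ¬uv , N⊆))
        ... | w , ¬imp = w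
            , decidable-stable (w ∈? S) (λ w∉ → ¬imp λ w∈ → contradiction w∈ w∉)
            , decidable-stable (adj? w u) (λ ¬wu → ¬imp λ _ wu → contradiction wu ¬wu)
            , (λ { refl → ¬imp λ _ wu → contradiction (Adj-sym wu) ¬uv })
            , λ wv → ¬imp λ _ _ → wv

        -- In the complement, private neighbors extend uv to a path x u v w y
        -- with no chord except possibly xy.
        main : Structure S
        main with private-neighbor u∈ v∈ (u≢v , ¬uv) | private-neighbor v∈ u∈ (apart-sym (u≢v , ¬uv))
        ... | w , w∈ , wu , wv | x , x∈ , xv , xu with adj? x w
        ...   | no ¬xw = from-2K₂ x∈ v∈ w∈ u∈ xv wu
                  ((λ { refl → proj₂ xu wu }) , ¬xw) xu (apart-sym wv) (apart-sym (u≢v , ¬uv))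
        ...   | yes xw with private-neighbor v∈ w∈ (apart-sym wv)
        ...     | y , y∈ , yv , yw with adj? y u
        ...       | no ¬yu = from-2K₂ y∈ v∈ u∈ w∈ yv (Adj-sym wu)
                      ((λ { refl → ¬uv yv }) , ¬yu) yw (apart-sym (u≢v , ¬uv)) (apart-sym wv)
        ...       | yes yu with adj? x y
        ...         | yes xy = contradiction
                        (induced house x u v w y xu xv xw xy (u≢v , ¬uv) (Adj-sym wu) (Adj-sym yu)
                          (apart-sym wv) (Adj-sym yv) (apart-sym yw))
                        noHouse
        -- The complement of the 5-cycle `x u v w y` is the 5-cycle `x v y u w`.
        ...         | no ¬xy = contradiction
                        (induced C₅ x v y u w xv ((λ { refl → proj₂ yw xw }) , ¬xy) xu xw
                          (Adj-sym yv) (apart-sym (u≢v , ¬uv)) (apart-sym wv)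
                          yu yw (Adj-sym wu))
                        noC₅

-- Induction over vertex sets.

module _ {n} (G : Graph n) where
  open DecMembership (_≟_ {n}) using (_∈?_)

  -- Passing to sublists of a duplicate-free `S` keeps the members and makes lengths count vertices.
  dominated-filter : ∀ {S A B} → Dominated G S A B →
    Dominated G S (filter (_∈? A) S) (filter (_∈? B) S)
  dominated-filter {S} {A} {B} D = record
    { A⊆ = proj₁ ∘ ∈-filter⁻ (_∈? A)
    ; B⊆ = proj₁ ∘ ∈-filter⁻ (_∈? B)
    ; a₀ = a₀ ; a₀∈ = ∈-filter⁺ (_∈? A) (A⊆ a₀∈) a₀∈
    ; b₀ = b₀ ; b₀∈ = ∈-filter⁺ (_∈? B) (B⊆ b₀∈) b₀∈
    ; apart = λ a∈ b∈ → apart (proj₂ (∈-filter⁻ (_∈? A) {xs = S} a∈)) (proj₂ (∈-filter⁻ (_∈? B) {xs = S} b∈))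
    ; dom = λ w∈ w∉ a∈ wa →
        let toA , toB = dom w∈ (w∉ ∘ ∈-filter⁺ (_∈? A) w∈) (proj₂ (∈-filter⁻ (_∈? A) {xs = S} a∈)) wa
        in (λ x∈ → toA (proj₂ (∈-filter⁻ (_∈? A) {xs = S} x∈))) , (λ b∈ → toB (proj₂ (∈-filter⁻ (_∈? B) {xs = S} b∈)))
    }
    where open Dominated D

  module _ (ℓ : ℕ) where

    clique-edgeless : ∀ {A} (g : Good G ℓ A) → Edgeless G A → Good.m g ≤ 1
    clique-edgeless record { m = 0 } _ = z≤n
    clique-edgeless record { m = 1 } _ = s≤s z≤n
    clique-edgeless record { m = suc (suc _) ; k∈ = k∈ ; k-adj = k-adj } edgeless =
      contradiction (k-adj {zero} {suc zero} λ ()) (edgeless (k∈ _) (k∈ _))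

    module _ (noP₅ : (P₅ -Free) G) (noC₅ : (C₅ -Free) G)
             (noHouse : (house -Free) G) (noCoBanner : (coBanner -Free) G) where

      -- Strong induction on the size of `S` with fuel `N`: `A′` misses `b₀`, `B′` misses `a₀`, and
      -- what remains after folding misses a vertex of the folded set.
      good : ∀ N S {x} → length S ≤ N → Unique S → x ∈ S → Good G ℓ S
      good zero [] _ _ ()
      good (suc N) S S≤N S! x∈ with structure G noP₅ noCoBanner noC₅ noHouse S
      ... | inj₁ complete = good-complete G ℓ x∈ S! complete
      ... | inj₂ (A , B , D , D⊎edgeless) = choose D⊎edgeless
        where
        open Dominated D
        A′ = filter (_∈? A) S
        B′ = filter (_∈? B) S
        smaller : ∀ {P : Pred (Fin n) 0ℓ} (P? : Decidable P) {y} → y ∈ S → ¬ P y →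
                  length (filter P? S) ≤ N
        smaller P? y∈ ¬Py = s≤s⁻¹ (≤-trans (filter-notAll P? S (lose y∈ ¬Py)) S≤N)
        gA : Good G ℓ A′
        gA = good N A′ (smaller (_∈? A) (B⊆ b₀∈) (λ b∈A → proj₁ (apart b∈A b₀∈) refl))
               (Unique.filter⁺ (_∈? A) S!) (∈-filter⁺ (_∈? A) (A⊆ a₀∈) a₀∈)
        gB : Good G ℓ B′
        gB = good N B′ (smaller (_∈? B) (A⊆ a₀∈) (λ a∈B → proj₁ (apart a₀∈ a∈B) refl))
               (Unique.filter⁺ (_∈? B) S!) (∈-filter⁺ (_∈? B) (B⊆ b₀∈) b₀∈)
        remove : ∀ {X Y} → Dominated G S X Y →
                 (gX : Good G ℓ (filter (_∈? X) S)) (gY : Good G ℓ (filter (_∈? Y) S)) →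
                 Good.m gX ≤ Good.m gY → Good G ℓ S
        remove {X} {Y} D gX gY mX≤mY =
          Fold.good-fold G ℓ S! (Unique.filter⁺ (_∈? X) S!) (dominated-filter D) gX gY mX≤mY
            (λ u∈ u∉ → ∈-filter⁺ X̄? u∈ (u∉ ∘ ∈-filter⁺ (_∈? X) u∈))
            (λ u∈ → proj₁ (∈-filter⁻ X̄? u∈) ,
                    λ u∈X → proj₂ (∈-filter⁻ X̄? {xs = S} u∈) (proj₂ (∈-filter⁻ (_∈? X) {xs = S} u∈X)))
            (≤-reflexive (length-filter-split G X S))
            (good N (filter X̄? S) (smaller X̄? (DX.A⊆ DX.a₀∈) (λ a∉ → a∉ DX.a₀∈))
              (Unique.filter⁺ X̄? S!)
              (∈-filter⁺ X̄? (DX.B⊆ DX.b₀∈) (λ b∈X → proj₁ (DX.apart b∈X DX.b₀∈) refl)))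
          where
          module DX = Dominated D
          X̄? = λ x → ¬? (x ∈? X)
        positive : ∀ {m} → Fin m → 1 ≤ m
        positive {suc _} _ = s≤s z≤n
        choose : Dominated G S B A ⊎ Edgeless G A → Good G ℓ S
        -- The clique of `B` is nonempty because its retraction has a value at `b₀`.
        choose (inj₂ edgeless) = remove D gA gB (≤-trans
                (clique-edgeless gA λ x∈ y∈ → edgeless (proj₂ (∈-filter⁻ (_∈? A) {xs = S} x∈))
                                                       (proj₂ (∈-filter⁻ (_∈? A) {xs = S} y∈)))
                (positive (Good.ρ gB b₀)))
        choose (inj₁ D′) with ≤-total (Good.m gA) (Good.m gB)
        ...   | inj₁ A≤B = remove D gA gB A≤B
        ...   | inj₂ B≤A = remove D′ gB gA B≤A

-- Walks, distances and the diameter of the reconfiguration graph.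

∑ : ∀ {n} → (Fin n → ℕ) → ℕ
∑ {zero}  κ = 0
∑ {suc n} κ = κ zero + ∑ (κ ∘ suc)

∑-mono : ∀ {n} {κ κ′ : Fin n → ℕ} → (∀ v → κ v ≤ κ′ v) → ∑ κ ≤ ∑ κ′
∑-mono {zero}  le = z≤n
∑-mono {suc n} le = +-mono-≤ (le zero) (∑-mono (le ∘ suc))

∑-strict : ∀ {n} {κ κ′ : Fin n → ℕ} v → κ v < κ′ v → (∀ v → κ v ≤ κ′ v) → ∑ κ < ∑ κ′
∑-strict zero    lt le = +-mono-≤ lt (∑-mono (le ∘ suc))
∑-strict (suc v) lt le = ≤-trans (≤-reflexive (sym (+-suc _ _))) (+-mono-≤ (le zero) (∑-strict v lt (le ∘ suc)))

∑-const : ∀ n t → ∑ {n} (const t) ≡ n * t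
∑-const zero t = refl
∑-const (suc n) t = cong (t +_) (∑-const n t)

module _ (H : SetoidGraph) where
  open SetoidGraph H
  module ≈ = Setoid vertices

  walk-resp : ∀ {u u′ v v′ k} → u ≈ u′ → v ≈ v′ → Walk H u v k → Walk H u′ v′ k
  walk-resp p q [ e ] = [ ≈.trans (≈.sym p) (≈.trans e q) ]
  walk-resp p q (a ∷ w) = proj₂ resp p a ∷ walk-resp ≈.refl q w

  walk-++ : ∀ {u v w j k} → Walk H u v j → Walk H v w k → Walk H u w (j + k)
  walk-++ [ e ] q = walk-resp (≈.sym e) ≈.refl q
  walk-++ (a ∷ p) q = a ∷ walk-++ p q

  walk-snoc : ∀ {u v w k} → Walk H u v k → SetoidGraph.Adj H v w → Walk H u w (suc k)
  walk-snoc [ e ] a = proj₂ resp (≈.sym e) a ∷ [ ≈.refl ]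
  walk-snoc (b ∷ p) a = b ∷ walk-snoc p a

  walk-reverse : ∀ {u v k} → Walk H u v k → Walk H v u k
  walk-reverse [ e ] = [ ≈.sym e ]
  walk-reverse (a ∷ p) = walk-snoc (walk-reverse p) (SetoidGraph.sym H a)

module _ {n} (G : Graph n) (ℓ : ℕ) where

  private
    R′ = R ℓ G
    open SetoidGraph R′ using (_≈_)

  -- A `step` may give a vertex the color it already has; such a step is dropped. Every other one
  -- becomes an edge and lowers the total allowance by at least one.
  path⇒walk : ∀ {κ} (c d : Coloring G ℓ) → Path G U U κ (proj₁ c) (proj₁ d) →
              ∃ λ k → Walk R′ c d k × k ≤ ∑ κ
  path⇒walk _ _ (done eq) = 0 , [ (λ v → eq _) ] , z≤n
  path⇒walk {κ′} (c , pc) (d , pd) (step {κ} {c′ = c′} x _ _ same ok κx κ≤ p)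
    with path⇒walk (c′ , λ u v uv → path-proper one (λ {u} {v} _ _ → pc u v) _ _ uv) (d , pd) p
       | c x ≟ c′ x
    where
    one : Path G U U κ′ c c′
    one = step {κ = κ} {κ′} {c} {c′} {c′} x _ _ same ok κx κ≤ (done λ _ → refl)
  ... | k , w , k≤ | yes e = k , walk-resp R′ c′≈c (λ _ → refl) w , ≤-trans k≤ (∑-mono κ≤)
    where
    c′≈c : ∀ v → c′ v ≡ c v
    c′≈c v with v ≟ x
    ... | yes refl = sym e
    ... | no v≢x = sym (same _ v≢x)
  ... | k , w , k≤ | no ne = suc k , (x , ne , λ u u≢x → same _ u≢x) ∷ w
                                   , ≤-trans (s≤s k≤) (∑-strict x κx κ≤)

  -- Colorings are enumerated as vectors, so one is recovered only up to pointwise equality and with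
  -- another proof of properness; hence `P` must respect `≈`.
  anyColoring? : {P : Coloring G ℓ → Set} → (∀ {c d} → c ≈ d → P c → P d) →
                 Decidable P → Dec (∃ P)
  anyColoring? {P} resp P? = map′ (λ (xs , pc , p) → (Vec.lookup xs , pc) , p)
    (λ ((c , pc) , p) → Vec.tabulate c , pt c pc , resp (λ v → sym (lookup∘tabulate c v)) p)
    (anyVec? n dec)
    where
    pt : ∀ c → Proper G c → Proper G (Vec.lookup (Vec.tabulate c))
    pt c pc u v uv e = pc u v uv
      (trans (sym (lookup∘tabulate c u)) (trans e (lookup∘tabulate c v)))
    dec : ∀ xs → Dec (∃ λ pc → P (Vec.lookup xs , pc))
    dec xs with proper? G (Vec.lookup xs)
    ... | no ¬pc = no (¬pc ∘ proj₁)
    ... | yes pc = map′ (pc ,_) (λ (_ , p) → resp (λ _ → refl) p) (P? (Vec.lookup xs , pc))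

  adjacent? : ∀ c d → Dec (SetoidGraph.Adj R′ c d)
  adjacent? (c , _) (d , _) =
    any? λ v → ¬? (c v ≟ d v) ×-dec all? λ u → ¬? (u ≟ v) →-dec (c u ≟ d u)

  walk? : ∀ c d k → Dec (Walk R′ c d k)
  walk? c d zero = map′ [_] (λ { [ e ] → e }) (all? λ v → proj₁ c v ≟ proj₁ d v)
  walk? c d (suc k) = map′ (λ (_ , a , w) → a ∷ w) (λ { (a ∷ w) → _ , a , w })
    (anyColoring? (λ {x} {y} x≈y (a , w) → proj₁ (SetoidGraph.resp R′) {c} {x} {y} x≈y a
                                         , walk-resp R′ x≈y (λ _ → refl) w)
                  (λ x → adjacent? c x ×-dec walk? x d k))

  module _ {D} (walks : ∀ c d → ∃ λ k → Walk R′ c d k × k ≤ D) where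

    private
      distance : ∀ c d → ∃ (IsDistance R′ c d)
      distance c d = least (walk? c d) _ (proj₁ (proj₂ (walks c d)))

      dist : ∀ c d → ℕ
      dist c d = proj₁ (distance c d)

      dist-mono : ∀ {c c′ d d′} → c ≈ c′ → d ≈ d′ → dist c d ≤ dist c′ d′
      dist-mono {c} {c′} {d} {d′} p q = proj₂ (proj₂ (distance c d)) _
        (walk-resp R′ (λ v → sym (p v)) (λ v → sym (q v)) (proj₁ (proj₂ (distance c′ d′))))

      attained? : ∀ b → Dec (∃₂ λ c d → b ≤ dist c d)
      attained? b = anyColoring? (λ p (d , le) → d , ≤-trans le (dist-mono p (λ _ → refl)))
        λ c → anyColoring? (λ p le → ≤-trans le (dist-mono {c} (λ _ → refl) p)) λ d → b ≤? dist c d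

    -- The search descends from `D`; the first value attained as a distance is the maximum. At zero
    -- the pair `c₀`, `c₀` attains it.
    diameter : Coloring G ℓ → ∃[ b ] (IsDiameter R′ b × b ≤ D)
    diameter c₀ = search D ≤-refl λ c d → let k , w , k≤ = walks c d in
                                          ≤-trans (proj₂ (proj₂ (distance c d)) k w) k≤
      where
      search : ∀ b → b ≤ D → (∀ c d → dist c d ≤ b) → ∃[ b ] (IsDiameter R′ b × b ≤ D)
      search b b≤D bound with attained? b
      ... | yes (c , d , le) = b ,
            ( (c , d , subst (IsDistance R′ c d) (≤-antisym (bound c d) le) (proj₂ (distance c d)))
            , λ c d → dist c d , proj₂ (distance c d) , bound c d) , b≤D
      search zero    b≤D bound | no ¬a = contradiction (c₀ , c₀ , z≤n) ¬a
      search (suc b) b≤D bound | no ¬a = search b (≤-trans (n≤1+n b) b≤D)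
        λ c d → s≤s⁻¹ (≰⇒> λ le → ¬a (c , d , le))

-- The quadratic bound.

module _ {n} {G : Graph n} {ℓ} (g : Good G ℓ (allFin n)) where
  open Good g

  private
    S = allFin n

    everywhere : ∀ {κ e f} → Path G (_∈ S) U κ e f → Path {ℓ = ℓ} G U U κ e f
    everywhere = embed (λ _ → yes (∈-allFin _)) _ _ (λ _ w∉ → contradiction (∈-allFin _) w∉)
      (λ _ → refl) (λ _ → refl) (λ _ w∉ → contradiction (∈-allFin _) w∉)

    -- A proper coloring through `ρ` is a coloring of the clique, so `permute` applies and is lifted
    -- back along `ρ`.
    between : Roomy m U → ∀ γ δ → Proper G (γ ∘ ρ) → Proper G (δ ∘ ρ) →
              Path {ℓ = ℓ} G U U (const m) (γ ∘ ρ) (δ ∘ ρ)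
    between room γ δ γ-proper δ-proper =
      everywhere (lift (Unique.allFin⁺ n) ρ _ ρ-adj (permute room δ (inj δ δ-proper) _ γ (inj γ γ-proper)))
      where
      inj : ∀ (σ : Fin m → Fin ℓ) → Proper G (σ ∘ ρ) → Injective _≡_ _≡_ σ
      inj σ σ-proper {i} {j} e = k-injective G ℓ g (σ ∘ ρ) (λ {u} {v} _ _ → σ-proper u v)
        (trans (cong σ (ρ-k i)) (trans e (cong σ (sym (ρ-k j)))))

    t+m≤n : t + m ≤ n
    t+m≤n = ≤-trans t+m≤ (≤-reflexive (length-tabulate id))

    -- A coloring with `χ G` colors is injective on the clique.
    m<ℓ : ℓ ≥ χ G + 1 → m < ℓ
    m<ℓ ℓ≥ = ≤-trans (s≤s (injective⇒≤ (k-injective G ℓ g (proj₁ c) λ {u} {v} _ _ → proj₂ c u v)))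
               (≤-trans (≤-reflexive (+-comm 1 (χ G))) ℓ≥)
      where
      c : Coloring G (χ G)
      c = proj₁ (proj₂ (chromaticNumber G))

    -- Grouped as `n * t` plus `n * (m + t)`, each at most `n * n` since `t + m ≤ n`.
    total : ∀ {k₁ k₂ k₃} → k₁ ≤ ∑ {n} (const t) → k₂ ≤ ∑ {n} (const m) → k₃ ≤ ∑ {n} (const t) →
            k₁ + (k₂ + k₃) ≤ 2 * n ^ 2
    total {k₁} {k₂} {k₃} k₁≤ k₂≤ k₃≤ = begin
      k₁ + (k₂ + k₃)
        ≤⟨ +-mono-≤ k₁≤ (+-mono-≤ k₂≤ k₃≤) ⟩
      ∑ {n} (const t) + (∑ {n} (const m) + ∑ {n} (const t))
        ≡⟨ cong₂ _+_ (∑-const n t) (cong₂ _+_ (∑-const n m) (∑-const n t)) ⟩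
      n * t + (n * m + n * t)
        ≡⟨ cong (n * t +_) (sym (*-distribˡ-+ n m t)) ⟩
      n * t + n * (m + t)
        ≤⟨ +-mono-≤ (*-monoʳ-≤ n (m+n≤o⇒m≤o t t+m≤n))
                    (*-monoʳ-≤ n (≤-trans (≤-reflexive (+-comm m t)) t+m≤n)) ⟩
      n * n + n * n
        ≡⟨ cong (λ x → n * x + n * x) (sym (*-identityʳ n)) ⟩
      n ^ 2 + n ^ 2
        ≡⟨ cong (n ^ 2 +_) (sym (+-identityʳ (n ^ 2))) ⟩
      2 * n ^ 2 ∎
      where open ≤-Reasoning

  good⇒walk : ℓ ≥ χ G + 1 → ∀ (c d : Coloring G ℓ) → ∃ λ k → Walk (R ℓ G) c d k × k ≤ 2 * n ^ 2
  good⇒walk ℓ≥ c d with canonical c | canonical d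
    where
    canonical : (e : Coloring G ℓ) → ∃ λ γ → Proper G (γ ∘ ρ) × Path G U U (const t) (proj₁ e) (γ ∘ ρ)
    canonical (e , pe) with reach (roomy id id _ (m<ℓ ℓ≥)) {e} (λ {u} {v} _ _ → pe u v) _
    ... | γ , p = γ , (λ u v → path-proper p (λ {u} {v} _ _ → pe u v) (∈-allFin u) (∈-allFin v)) , everywhere p
  ... | γ , γ-proper , p | δ , δ-proper , q
    with path⇒walk G ℓ c (γ ∘ ρ , γ-proper) p
       | path⇒walk G ℓ (γ ∘ ρ , γ-proper) (δ ∘ ρ , δ-proper)
           (between (roomy id id _ (m<ℓ ℓ≥)) γ δ γ-proper δ-proper)
       | path⇒walk G ℓ d (δ ∘ ρ , δ-proper) q
  ... | k₁ , w₁ , k₁≤ | k₂ , w₂ , k₂≤ | k₃ , w₃ , k₃≤ =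
    k₁ + (k₂ + k₃) , walk-++ (R ℓ G) w₁ (walk-++ (R ℓ G) w₂ (walk-reverse (R ℓ G) w₃)) , total k₁≤ k₂≤ k₃≤

short-walk : ∀ {n} (G : Graph n) → (P₅ -Free) G → (C₅ -Free) G → (house -Free) G → (coBanner -Free) G →
             ∀ ℓ → ℓ ≥ χ G + 1 → ∀ (c d : Coloring G ℓ) → ∃ λ k → Walk (R ℓ G) c d k × k ≤ 2 * n ^ 2
-- The empty graph is separate because `good` asks for a member of the vertex set.
short-walk {zero} G _ _ _ _ ℓ _ c d = 0 , [ (λ ()) ] , z≤n
short-walk {suc n} G noP₅ noC₅ noHouse noCoBanner ℓ =
  good⇒walk (good G ℓ noP₅ noC₅ noHouse noCoBanner (length S) S ≤-refl
                  (Unique.allFin⁺ (suc n)) (here refl))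
  where
  S = allFin (suc n)

theorem15 : ∀ (n : ℕ) (G : Graph n) → (P₅ -Free) G → (C₅ -Free) G → (house -Free) G → (coBanner -Free) G →
    Recolorable G × (∀ ℓ → ℓ ≥ χ G + 1 → ∃[ d ] (IsDiameter (R ℓ G) d × d ≤ 2 * n ^ 2))
theorem15 n G noP₅ noC₅ noHouse noCoBanner =
  (λ ℓ ℓ≥ c d → let k , w , _ = connect ℓ ℓ≥ c d in k , w) ,
  λ ℓ ℓ≥ → diameter G ℓ (connect ℓ ℓ≥) (coloring ℓ ℓ≥)
  where
  connect = short-walk G noP₅ noC₅ noHouse noCoBanner
  -- `IsDiameter` presupposes a vertex; an optimal coloring, read with more colors, supplies one.
  coloring : ∀ ℓ → ℓ ≥ χ G + 1 → Coloring G ℓ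
  coloring ℓ ℓ≥ = let (c , pc) = proj₁ (proj₂ (chromaticNumber G)) in
    (λ v → inject≤ (c v) χ≤ℓ) , λ u v uv e → pc u v uv (inject≤-injective _ _ _ _ e)
    where
    χ≤ℓ : χ G ≤ ℓ
    χ≤ℓ = ≤-trans (m≤m+n (χ G) 1) ℓ≥
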